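{- The logic $\mathcal{LB}=\langle\mathbf{Fm},\mathbf C_{\mathcal{LB}}\rangle$ satisfies the following properties (with $\mathbf C=\mathbf C_{\mathcal{LB}}$): for all $\Gamma\cup\{\varphi,\psi\}\subseteq Fm$, (PC) $\mathbf C(\varphi\land\psi)=\mathbf C(\varphi\otimes\psi)=\mathbf C(\varphi,\psi)$; (PDI) $\mathbf C(\Gamma,\varphi\lor\psi)=\mathbf C(\Gamma,\varphi\oplus\psi)=\mathbf C(\Gamma,\varphi)\cap\mathbf C(\Gamma,\psi)$; (PDN) $\mathbf C(\varphi)=\mathbf C(\neg\neg\varphi)$; (PDM) $\mathbf C(\neg(\varphi\land\psi))=\mathbf C(\neg\varphi\lor\neg\psi)$, $\mathbf C(\neg(\varphi\lor\psi))=\mathbf C(\neg\varphi\land\neg\psi)$, $\mathbf C(\neg(\varphi\otimes\psi))=\mathbf C(\neg\varphi\otimes\neg\psi)$, $\mathbf C(\neg(\varphi\oplus\psi))=\mathbf C(\neg\varphi\oplus\neg\psi)$. Moreover, $\mathcal{LB}$ is the only consistent logic $\langle \mathbf{Fm},\mathbf C\rangle$ satisfying (PC), (PDI), (PDN) and (PDM).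
   Context: $\mathbf{Fm}$ is the algebra of formulas (with universe $Fm$) over a countable set of variables in the language $\{\land,\lor,\otimes,\oplus,\neg\}$ ($\land,\lor,\otimes,\oplus$ binary, $\neg$ unary, no constants). A logic is a pair $\langle\mathbf{Fm},\mathbf C\rangle$ where $\mathbf C$ is a structural (substitution-invariant) closure operator on $Fm$; it is consistent if there are $\varphi,\psi\in Fm$ with $\psi\notin\mathbf C(\varphi)$. Notation: $\mathbf C(\Gamma,\varphi)=\mathbf C(\Gamma\cup\{\varphi\})$. $\mathcal{FOUR}$ is the algebra with universe $\{\mathsf f,\bot,\top,\mathsf t\}$ where $\land,\lor$ are meet and join of the lattice order $\leq_t$ with $\mathsf f <_t \bot,\top <_t \mathsf t$ ($\bot,\top$ $\leq_t$-incomparable), $\otimes,\oplus$ are meet and join of the lattice order $\leq_k$ with $\bot <_k \mathsf f,\mathsf t <_k \top$ ($\mathsf f,\mathsf t$ $\leq_k$-incomparable), and $\neg \mathsf f = \mathsf t$, $\neg\mathsf t=\mathsf f$, $\neg\bot=\bot$, $\neg\top=\top$. Let $\mathsf{Tr}=\{\top,\mathsf t\}$. $\mathcal{LB}$ is the logic with $\varphi\in\mathbf C_{\mathcal{LB}}(\Gamma)$ iff for every homomorphism $h:\mathbf{Fm}\to\mathcal{FOUR}$, $h[\Gamma]\subseteq \mathsf{Tr}$ implies $h(\varphi)\in\mathsf{Tr}$. -}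

module Defs where

open import Data.Nat using (ℕ)
open import Data.Product using (∃-syntax; _×_; _,_)
open import Level using (0ℓ)
open import Relation.Binary.Definitions using (Transitive; Antisymmetric)
open import Relation.Binary.Lattice using (IsLattice)
open import Relation.Binary.PropositionalEquality using (_≡_; refl; isEquivalence)
open import Relation.Unary using (Pred; _∈_; _∉_; _⊆_; _≐_; _∩_; _∪_; ｛_｝)

record Algebra : Set₁ where
  field
    Carrier : Set
    and or otimes oplus : Carrier → Carrier → Carrier
    neg : Carrier → Carrier

record IsHomomorphism (A B : Algebra)
                      (h : Algebra.Carrier A → Algebra.Carrier B) : Set where
  private
    module A = Algebra A
    module B = Algebra B
  field
    and-homo    : ∀ x y → h (A.and x y) ≡ B.and (h x) (h y)
    or-homo     : ∀ x y → h (A.or x y) ≡ B.or (h x) (h y)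
    otimes-homo : ∀ x y → h (A.otimes x y) ≡ B.otimes (h x) (h y)
    oplus-homo  : ∀ x y → h (A.oplus x y) ≡ B.oplus (h x) (h y)
    neg-homo    : ∀ x → h (A.neg x) ≡ B.neg (h x)

infixr 7 _∧_ _⊗_
infixr 6 _∨_ _⊕_
infix  8 ¬_

data Fm : Set where
  var             : ℕ → Fm
  _∧_ _∨_ _⊗_ _⊕_ : Fm → Fm → Fm
  ¬_              : Fm → Fm

𝐅𝐦 : Algebra
𝐅𝐦 = record
  { Carrier = Fm ; and = _∧_ ; or = _∨_ ; otimes = _⊗_ ; oplus = _⊕_ ; neg = ¬_ }

data Four : Set where
  f₄ ⊥₄ ⊤₄ t₄ : Four

infix 4 _≤t_ _≤k_

data _≤t_ : Four → Four → Set where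
  reflₜ : ∀ {x} → x ≤t x
  minₜ  : ∀ {x} → f₄ ≤t x
  maxₜ  : ∀ {x} → x ≤t t₄

data _≤k_ : Four → Four → Set where
  reflₖ : ∀ {x} → x ≤k x
  minₖ  : ∀ {x} → ⊥₄ ≤k x
  maxₖ  : ∀ {x} → x ≤k ⊤₄

infixr 7 _∧₄_ _⊗₄_
infixr 6 _∨₄_ _⊕₄_
infix  8 ¬₄_

_∧₄_ _∨₄_ _⊗₄_ _⊕₄_ : Four → Four → Four

f₄ ∧₄ y  = f₄
t₄ ∧₄ y  = y
⊥₄ ∧₄ f₄ = f₄
⊥₄ ∧₄ ⊥₄ = ⊥₄
⊥₄ ∧₄ ⊤₄ = f₄
⊥₄ ∧₄ t₄ = ⊥₄
⊤₄ ∧₄ f₄ = f₄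
⊤₄ ∧₄ ⊥₄ = f₄
⊤₄ ∧₄ ⊤₄ = ⊤₄
⊤₄ ∧₄ t₄ = ⊤₄

f₄ ∨₄ y  = y
t₄ ∨₄ y  = t₄
⊥₄ ∨₄ f₄ = ⊥₄
⊥₄ ∨₄ ⊥₄ = ⊥₄
⊥₄ ∨₄ ⊤₄ = t₄
⊥₄ ∨₄ t₄ = t₄
⊤₄ ∨₄ f₄ = ⊤₄
⊤₄ ∨₄ ⊥₄ = t₄
⊤₄ ∨₄ ⊤₄ = ⊤₄
⊤₄ ∨₄ t₄ = t₄

⊥₄ ⊗₄ y  = ⊥₄
⊤₄ ⊗₄ y  = y
f₄ ⊗₄ f₄ = f₄
f₄ ⊗₄ ⊥₄ = ⊥₄
f₄ ⊗₄ ⊤₄ = f₄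
f₄ ⊗₄ t₄ = ⊥₄
t₄ ⊗₄ f₄ = ⊥₄
t₄ ⊗₄ ⊥₄ = ⊥₄
t₄ ⊗₄ ⊤₄ = t₄
t₄ ⊗₄ t₄ = t₄

⊥₄ ⊕₄ y  = y
⊤₄ ⊕₄ y  = ⊤₄
f₄ ⊕₄ f₄ = f₄
f₄ ⊕₄ ⊥₄ = f₄
f₄ ⊕₄ ⊤₄ = ⊤₄
f₄ ⊕₄ t₄ = ⊤₄
t₄ ⊕₄ f₄ = ⊤₄
t₄ ⊕₄ ⊥₄ = t₄
t₄ ⊕₄ ⊤₄ = ⊤₄
t₄ ⊕₄ t₄ = t₄

¬₄_ : Four → Four
¬₄ f₄ = t₄
¬₄ ⊥₄ = ⊥₄
¬₄ ⊤₄ = ⊤₄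
¬₄ t₄ = f₄

≤t-isLattice : IsLattice _≡_ _≤t_ _∨₄_ _∧₄_
≤t-isLattice = record
  { isPartialOrder = record
    { isPreorder = record
      { isEquivalence = isEquivalence
      ; reflexive = λ { refl → reflₜ }
      ; trans = trans
      }
    ; antisym = antisym
    }
  ; supremum = λ x y → ub₁ x y , ub₂ x y , λ z → lub {x} {y} {z}
  ; infimum = λ x y → lb₁ x y , lb₂ x y , λ z → glb {x} {y} {z}
  }
  where
  trans : Transitive _≤t_
  trans reflₜ q     = q
  trans minₜ  q     = minₜ
  trans maxₜ  reflₜ = maxₜ
  trans maxₜ  maxₜ  = maxₜ

  antisym : Antisymmetric _≡_ _≤t_
  antisym reflₜ q     = refl
  antisym minₜ  reflₜ = refl
  antisym minₜ  minₜ  = refl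
  antisym maxₜ  reflₜ = refl
  antisym maxₜ  maxₜ  = refl

  ub₁ : ∀ x y → x ≤t x ∨₄ y
  ub₁ f₄ y  = minₜ
  ub₁ t₄ y  = reflₜ
  ub₁ ⊥₄ f₄ = reflₜ
  ub₁ ⊥₄ ⊥₄ = reflₜ
  ub₁ ⊥₄ ⊤₄ = maxₜ
  ub₁ ⊥₄ t₄ = maxₜ
  ub₁ ⊤₄ f₄ = reflₜ
  ub₁ ⊤₄ ⊥₄ = maxₜ
  ub₁ ⊤₄ ⊤₄ = reflₜ
  ub₁ ⊤₄ t₄ = maxₜ

  ub₂ : ∀ x y → y ≤t x ∨₄ y
  ub₂ f₄ y  = reflₜ
  ub₂ t₄ y  = maxₜ
  ub₂ ⊥₄ f₄ = minₜ
  ub₂ ⊥₄ ⊥₄ = reflₜ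
  ub₂ ⊥₄ ⊤₄ = maxₜ
  ub₂ ⊥₄ t₄ = maxₜ
  ub₂ ⊤₄ f₄ = minₜ
  ub₂ ⊤₄ ⊥₄ = maxₜ
  ub₂ ⊤₄ ⊤₄ = reflₜ
  ub₂ ⊤₄ t₄ = maxₜ

  lb₁ : ∀ x y → x ∧₄ y ≤t x
  lb₁ f₄ y  = reflₜ
  lb₁ t₄ y  = maxₜ
  lb₁ ⊥₄ f₄ = minₜ
  lb₁ ⊥₄ ⊥₄ = reflₜ
  lb₁ ⊥₄ ⊤₄ = minₜ
  lb₁ ⊥₄ t₄ = reflₜ
  lb₁ ⊤₄ f₄ = minₜ
  lb₁ ⊤₄ ⊥₄ = minₜ
  lb₁ ⊤₄ ⊤₄ = reflₜ
  lb₁ ⊤₄ t₄ = reflₜ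

  lb₂ : ∀ x y → x ∧₄ y ≤t y
  lb₂ f₄ y  = minₜ
  lb₂ t₄ y  = reflₜ
  lb₂ ⊥₄ f₄ = reflₜ
  lb₂ ⊥₄ ⊥₄ = reflₜ
  lb₂ ⊥₄ ⊤₄ = minₜ
  lb₂ ⊥₄ t₄ = maxₜ
  lb₂ ⊤₄ f₄ = reflₜ
  lb₂ ⊤₄ ⊥₄ = minₜ
  lb₂ ⊤₄ ⊤₄ = reflₜ
  lb₂ ⊤₄ t₄ = maxₜ

  lub : ∀ {x y z} → x ≤t z → y ≤t z → x ∨₄ y ≤t z
  lub {x}  {y} minₜ  q     = q
  lub          maxₜ  q     = maxₜ
  lub {x}      reflₜ maxₜ  = maxₜ
  lub {f₄}     reflₜ q     = q
  lub {t₄}     reflₜ q     = reflₜ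
  lub {⊥₄}     reflₜ reflₜ = reflₜ
  lub {⊥₄}     reflₜ minₜ  = reflₜ
  lub {⊤₄}     reflₜ reflₜ = reflₜ
  lub {⊤₄}     reflₜ minₜ  = reflₜ

  glb : ∀ {x y z} → z ≤t x → z ≤t y → z ≤t x ∧₄ y
  glb          minₜ  q     = minₜ
  glb          maxₜ  q     = q
  glb          reflₜ minₜ  = minₜ
  glb {f₄}     reflₜ q     = reflₜ
  glb {t₄}     reflₜ q     = q
  glb {⊥₄}     reflₜ reflₜ = reflₜ
  glb {⊥₄}     reflₜ maxₜ  = reflₜ
  glb {⊤₄}     reflₜ reflₜ = reflₜ
  glb {⊤₄}     reflₜ maxₜ  = reflₜ

≤k-isLattice : IsLattice _≡_ _≤k_ _⊕₄_ _⊗₄_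
≤k-isLattice = record
  { isPartialOrder = record
    { isPreorder = record
      { isEquivalence = isEquivalence
      ; reflexive = λ { refl → reflₖ }
      ; trans = trans
      }
    ; antisym = antisym
    }
  ; supremum = λ x y → ub₁ x y , ub₂ x y , λ z → lub {x} {y} {z}
  ; infimum = λ x y → lb₁ x y , lb₂ x y , λ z → glb {x} {y} {z}
  }
  where
  trans : Transitive _≤k_
  trans reflₖ q     = q
  trans minₖ  q     = minₖ
  trans maxₖ  reflₖ = maxₖ
  trans maxₖ  maxₖ  = maxₖ

  antisym : Antisymmetric _≡_ _≤k_
  antisym reflₖ q     = refl
  antisym minₖ  reflₖ = refl
  antisym minₖ  minₖ  = refl
  antisym maxₖ  reflₖ = refl
  antisym maxₖ  maxₖ  = refl

  ub₁ : ∀ x y → x ≤k x ⊕₄ y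
  ub₁ ⊥₄ y  = minₖ
  ub₁ ⊤₄ y  = reflₖ
  ub₁ f₄ ⊥₄ = reflₖ
  ub₁ f₄ f₄ = reflₖ
  ub₁ f₄ t₄ = maxₖ
  ub₁ f₄ ⊤₄ = maxₖ
  ub₁ t₄ ⊥₄ = reflₖ
  ub₁ t₄ f₄ = maxₖ
  ub₁ t₄ t₄ = reflₖ
  ub₁ t₄ ⊤₄ = maxₖ

  ub₂ : ∀ x y → y ≤k x ⊕₄ y
  ub₂ ⊥₄ y  = reflₖ
  ub₂ ⊤₄ y  = maxₖ
  ub₂ f₄ ⊥₄ = minₖ
  ub₂ f₄ f₄ = reflₖ
  ub₂ f₄ t₄ = maxₖ
  ub₂ f₄ ⊤₄ = maxₖ
  ub₂ t₄ ⊥₄ = minₖ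
  ub₂ t₄ f₄ = maxₖ
  ub₂ t₄ t₄ = reflₖ
  ub₂ t₄ ⊤₄ = maxₖ

  lb₁ : ∀ x y → x ⊗₄ y ≤k x
  lb₁ ⊥₄ y  = reflₖ
  lb₁ ⊤₄ y  = maxₖ
  lb₁ f₄ ⊥₄ = minₖ
  lb₁ f₄ f₄ = reflₖ
  lb₁ f₄ t₄ = minₖ
  lb₁ f₄ ⊤₄ = reflₖ
  lb₁ t₄ ⊥₄ = minₖ
  lb₁ t₄ f₄ = minₖ
  lb₁ t₄ t₄ = reflₖ
  lb₁ t₄ ⊤₄ = reflₖ

  lb₂ : ∀ x y → x ⊗₄ y ≤k y
  lb₂ ⊥₄ y  = minₖ
  lb₂ ⊤₄ y  = reflₖ
  lb₂ f₄ ⊥₄ = reflₖ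
  lb₂ f₄ f₄ = reflₖ
  lb₂ f₄ t₄ = minₖ
  lb₂ f₄ ⊤₄ = maxₖ
  lb₂ t₄ ⊥₄ = reflₖ
  lb₂ t₄ f₄ = minₖ
  lb₂ t₄ t₄ = reflₖ
  lb₂ t₄ ⊤₄ = maxₖ

  lub : ∀ {x y z} → x ≤k z → y ≤k z → x ⊕₄ y ≤k z
  lub {x}  {y} minₖ  q     = q
  lub          maxₖ  q     = maxₖ
  lub {x}      reflₖ maxₖ  = maxₖ
  lub {⊥₄}     reflₖ q     = q
  lub {⊤₄}     reflₖ q     = reflₖ
  lub {f₄}     reflₖ reflₖ = reflₖ
  lub {f₄}     reflₖ minₖ  = reflₖ
  lub {t₄}     reflₖ reflₖ = reflₖ
  lub {t₄}     reflₖ minₖ  = reflₖ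

  glb : ∀ {x y z} → z ≤k x → z ≤k y → z ≤k x ⊗₄ y
  glb          minₖ  q     = minₖ
  glb          maxₖ  q     = q
  glb          reflₖ minₖ  = minₖ
  glb {⊥₄}     reflₖ q     = reflₖ
  glb {⊤₄}     reflₖ q     = q
  glb {f₄}     reflₖ reflₖ = reflₖ
  glb {f₄}     reflₖ maxₖ  = reflₖ
  glb {t₄}     reflₖ reflₖ = reflₖ
  glb {t₄}     reflₖ maxₖ  = reflₖ

𝓕𝓞𝓤𝓡 : Algebra
𝓕𝓞𝓤𝓡 = record
  { Carrier = Four ; and = _∧₄_ ; or = _∨₄_ ; otimes = _⊗₄_ ; oplus = _⊕₄_ ; neg = ¬₄_ }

data Tr : Pred Four 0ℓ where
  ⊤∈Tr : Tr ⊤₄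
  t∈Tr : Tr t₄

Operator : Set₁
Operator = Pred Fm 0ℓ → Pred Fm 0ℓ

_[_] : (Fm → Fm) → Pred Fm 0ℓ → Pred Fm 0ℓ
(σ [ Γ ]) ψ = ∃[ φ ] φ ∈ Γ × σ φ ≡ ψ

-- Sets of formulas are compared up to extensional equality _≐_; monotonicity
-- makes every closure operator respect it.
record IsLogic (C : Operator) : Set₁ where
  field
    extensive  : ∀ Γ → Γ ⊆ C Γ
    monotone   : ∀ Γ Δ → Γ ⊆ Δ → C Γ ⊆ C Δ
    idempotent : ∀ Γ → C (C Γ) ≐ C Γ
    structural : ∀ σ → IsHomomorphism 𝐅𝐦 𝐅𝐦 σ →
                 ∀ Γ φ → φ ∈ C Γ → σ φ ∈ C (σ [ Γ ])

Consistent : Operator → Set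
Consistent C = ∃[ φ ] ∃[ ψ ] ψ ∉ C ｛ φ ｝

-- For arbitrary Γ the finitarity of this relation is a compactness fact, hence
-- classical.  Already for Γ = { p ∣ P } one has p ∈ C-LB Γ exactly when P is not
-- refuted, whereas p follows from finitely many elements of Γ exactly when P
-- holds; so the uniqueness of C-LB among all operators implies excluded middle.
C-LB : Operator
C-LB Γ φ = ∀ h → IsHomomorphism 𝐅𝐦 𝓕𝓞𝓤𝓡 h →
           (∀ {γ} → γ ∈ Γ → h γ ∈ Tr) → h φ ∈ Tr

PC : Operator → Set
PC C = ∀ φ ψ →
  C ｛ φ ∧ ψ ｝ ≐ C ｛ φ ⊗ ψ ｝ ×
  C ｛ φ ⊗ ψ ｝ ≐ C (｛ φ ｝ ∪ ｛ ψ ｝)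

PDI : Operator → Set₁
PDI C = ∀ Γ φ ψ →
  C (Γ ∪ ｛ φ ∨ ψ ｝) ≐ C (Γ ∪ ｛ φ ⊕ ψ ｝) ×
  C (Γ ∪ ｛ φ ⊕ ψ ｝) ≐ C (Γ ∪ ｛ φ ｝) ∩ C (Γ ∪ ｛ ψ ｝)

PDN : Operator → Set
PDN C = ∀ φ → C ｛ φ ｝ ≐ C ｛ ¬ ¬ φ ｝

PDM : Operator → Set
PDM C = ∀ φ ψ →
  C ｛ ¬ (φ ∧ ψ) ｝ ≐ C ｛ ¬ φ ∨ ¬ ψ ｝ ×
  C ｛ ¬ (φ ∨ ψ) ｝ ≐ C ｛ ¬ φ ∧ ¬ ψ ｝ ×
  C ｛ ¬ (φ ⊗ ψ) ｝ ≐ C ｛ ¬ φ ⊗ ¬ ψ ｝ ×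
  C ｛ ¬ (φ ⊕ ψ) ｝ ≐ C ｛ ¬ φ ⊕ ¬ ψ ｝

{-# OPTIONS --safe #-}

-- Write a ⊢ b for b ∈ C { a }.  Let F be a filter and I an ideal of ⊢, and let h
-- be a homomorphism into FOUR such that every literal lies in F when h makes it
-- true and in I otherwise.  By (PC), (PDI), (PDN) and (PDM) the same then holds
-- for every formula.  Both inclusions follow from a suitable choice of F and I.
--
-- C Γ ⊆ C-LB Γ: suppose h makes Γ true but not φ, and let α, β be arbitrary.
-- Put B = α ⊕ ¬ α and N = β ⊗ ¬ β, so that α entails B and ¬ B, and β is entailed
-- by N and by ¬ N.  The substitution σ sending each variable to B, N, B ∨ N or
-- B ∧ N according to its value ⊤, ⊥, t or f has α ⊢ σ γ for all γ ∈ Γ, and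
-- σ φ ⊢ β.  By structurality φ ∈ C Γ gives α ⊢ β, against consistency.
--
-- C-LB Γ ⊆ C Γ: if φ ∉ C Γ, no finite meet of Γ entails φ.  Adding the literals
-- one at a time either to Γ or to { φ } preserves this separation, and in the
-- limit yields F, I and an h that makes Γ true but not φ.
module Submission where

open import Defs
open import Level using (0ℓ)
open import Axiom.ExcludedMiddle using (ExcludedMiddle)
open import Data.Empty using (⊥; ⊥-elim)
open import Data.Nat using (ℕ; zero; suc; _≤′_; ≤′-refl; ≤′-step)
  renaming (_⊔_ to _⊔ℕ_)
open import Data.Nat.Properties using (≤⇒≤′; m≤m⊔n; m≤n⊔m)
open import Data.Product using (Σ; ∃-syntax; _×_; _,_; proj₁; proj₂)
open import Data.Sum using (_⊎_; inj₁; inj₂)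
open import Function using (_∘_; id)
open import Relation.Binary.PropositionalEquality
  using (_≡_; refl; sym; trans; cong; subst)
open import Relation.Nullary using (Dec; yes; no)
open import Relation.Nullary.Decidable
  using (map′; from-yes; _×-dec_; _⊎-dec_; _→-dec_)
open import Relation.Unary
  using (Pred; Decidable; _∈_; _∉_; _⊆_; _≐_; _∩_; _∪_; ｛_｝; ∅)

private
  variable
    Γ Δ P Q : Pred Fm 0ℓ
    a b c d : Fm

-- The matrix ⟨FOUR, Tr⟩

-- `Four` is finite, so claims about its truth tables are decidable and evaluation proves them.
∀₄? : {R : Pred Four 0ℓ} → Decidable R → Dec (∀ v → R v)
∀₄? R? = map′
  (λ { (f , n , b , t) → λ { f₄ → f ; ⊥₄ → n ; ⊤₄ → b ; t₄ → t } })
  (λ r → r f₄ , r ⊥₄ , r ⊤₄ , r t₄)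
  (R? f₄ ×-dec R? ⊥₄ ×-dec R? ⊤₄ ×-dec R? t₄)

Tr? : Decidable Tr
Tr? f₄ = no λ ()
Tr? ⊥₄ = no λ ()
Tr? ⊤₄ = yes ⊤∈Tr
Tr? t₄ = yes t∈Tr

∧₄-Tr⁻ : ∀ u v → u ∧₄ v ∈ Tr → u ∈ Tr × v ∈ Tr
∧₄-Tr⁻ = from-yes (∀₄? λ u → ∀₄? λ v → Tr? (u ∧₄ v) →-dec (Tr? u ×-dec Tr? v))

∧₄-Tr⁺ : ∀ u v → u ∈ Tr × v ∈ Tr → u ∧₄ v ∈ Tr
∧₄-Tr⁺ = from-yes (∀₄? λ u → ∀₄? λ v → (Tr? u ×-dec Tr? v) →-dec Tr? (u ∧₄ v))

⊗₄-Tr⁻ : ∀ u v → u ⊗₄ v ∈ Tr → u ∈ Tr × v ∈ Tr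
⊗₄-Tr⁻ = from-yes (∀₄? λ u → ∀₄? λ v → Tr? (u ⊗₄ v) →-dec (Tr? u ×-dec Tr? v))

⊗₄-Tr⁺ : ∀ u v → u ∈ Tr × v ∈ Tr → u ⊗₄ v ∈ Tr
⊗₄-Tr⁺ = from-yes (∀₄? λ u → ∀₄? λ v → (Tr? u ×-dec Tr? v) →-dec Tr? (u ⊗₄ v))

∨₄-Tr⁻ : ∀ u v → u ∨₄ v ∈ Tr → u ∈ Tr ⊎ v ∈ Tr
∨₄-Tr⁻ = from-yes (∀₄? λ u → ∀₄? λ v → Tr? (u ∨₄ v) →-dec (Tr? u ⊎-dec Tr? v))

∨₄-Tr⁺ : ∀ u v → u ∈ Tr ⊎ v ∈ Tr → u ∨₄ v ∈ Tr
∨₄-Tr⁺ = from-yes (∀₄? λ u → ∀₄? λ v → (Tr? u ⊎-dec Tr? v) →-dec Tr? (u ∨₄ v))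

⊕₄-Tr⁻ : ∀ u v → u ⊕₄ v ∈ Tr → u ∈ Tr ⊎ v ∈ Tr
⊕₄-Tr⁻ = from-yes (∀₄? λ u → ∀₄? λ v → Tr? (u ⊕₄ v) →-dec (Tr? u ⊎-dec Tr? v))

⊕₄-Tr⁺ : ∀ u v → u ∈ Tr ⊎ v ∈ Tr → u ⊕₄ v ∈ Tr
⊕₄-Tr⁺ = from-yes (∀₄? λ u → ∀₄? λ v → (Tr? u ⊎-dec Tr? v) →-dec Tr? (u ⊕₄ v))

_≟₄_ : ∀ (u v : Four) → Dec (u ≡ v)
f₄ ≟₄ f₄ = yes refl
f₄ ≟₄ ⊥₄ = no λ ()
f₄ ≟₄ ⊤₄ = no λ ()
f₄ ≟₄ t₄ = no λ ()
⊥₄ ≟₄ f₄ = no λ ()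
⊥₄ ≟₄ ⊥₄ = yes refl
⊥₄ ≟₄ ⊤₄ = no λ ()
⊥₄ ≟₄ t₄ = no λ ()
⊤₄ ≟₄ f₄ = no λ ()
⊤₄ ≟₄ ⊥₄ = no λ ()
⊤₄ ≟₄ ⊤₄ = yes refl
⊤₄ ≟₄ t₄ = no λ ()
t₄ ≟₄ f₄ = no λ ()
t₄ ≟₄ ⊥₄ = no λ ()
t₄ ≟₄ ⊤₄ = no λ ()
t₄ ≟₄ t₄ = yes refl

¬₄-involutive : ∀ u → u ≡ ¬₄ ¬₄ u
¬₄-involutive = from-yes (∀₄? λ u → u ≟₄ (¬₄ ¬₄ u))

¬₄-∧₄ : ∀ u v → ¬₄ (u ∧₄ v) ≡ ¬₄ u ∨₄ ¬₄ v
¬₄-∧₄ = from-yes (∀₄? λ u → ∀₄? λ v → (¬₄ (u ∧₄ v)) ≟₄ (¬₄ u ∨₄ ¬₄ v))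

¬₄-∨₄ : ∀ u v → ¬₄ (u ∨₄ v) ≡ ¬₄ u ∧₄ ¬₄ v
¬₄-∨₄ = from-yes (∀₄? λ u → ∀₄? λ v → (¬₄ (u ∨₄ v)) ≟₄ (¬₄ u ∧₄ ¬₄ v))

¬₄-⊗₄ : ∀ u v → ¬₄ (u ⊗₄ v) ≡ ¬₄ u ⊗₄ ¬₄ v
¬₄-⊗₄ = from-yes (∀₄? λ u → ∀₄? λ v → (¬₄ (u ⊗₄ v)) ≟₄ (¬₄ u ⊗₄ ¬₄ v))

¬₄-⊕₄ : ∀ u v → ¬₄ (u ⊕₄ v) ≡ ¬₄ u ⊕₄ ¬₄ v
¬₄-⊕₄ = from-yes (∀₄? λ u → ∀₄? λ v → (¬₄ (u ⊕₄ v)) ≟₄ (¬₄ u ⊕₄ ¬₄ v))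

module _ {h : Fm → Four} (hom : IsHomomorphism 𝐅𝐦 𝓕𝓞𝓤𝓡 h) where
  open IsHomomorphism hom

  ∧-Tr⁻ : h (a ∧ b) ∈ Tr → h a ∈ Tr × h b ∈ Tr
  ∧-Tr⁻ = ∧₄-Tr⁻ _ _ ∘ subst Tr (and-homo _ _)

  ∧-Tr⁺ : h a ∈ Tr × h b ∈ Tr → h (a ∧ b) ∈ Tr
  ∧-Tr⁺ = subst Tr (sym (and-homo _ _)) ∘ ∧₄-Tr⁺ _ _

  ⊗-Tr⁻ : h (a ⊗ b) ∈ Tr → h a ∈ Tr × h b ∈ Tr
  ⊗-Tr⁻ = ⊗₄-Tr⁻ _ _ ∘ subst Tr (otimes-homo _ _)

  ⊗-Tr⁺ : h a ∈ Tr × h b ∈ Tr → h (a ⊗ b) ∈ Tr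
  ⊗-Tr⁺ = subst Tr (sym (otimes-homo _ _)) ∘ ⊗₄-Tr⁺ _ _

  ∨-Tr⁻ : h (a ∨ b) ∈ Tr → h a ∈ Tr ⊎ h b ∈ Tr
  ∨-Tr⁻ = ∨₄-Tr⁻ _ _ ∘ subst Tr (or-homo _ _)

  ∨-Tr⁺ : h a ∈ Tr ⊎ h b ∈ Tr → h (a ∨ b) ∈ Tr
  ∨-Tr⁺ = subst Tr (sym (or-homo _ _)) ∘ ∨₄-Tr⁺ _ _

  ⊕-Tr⁻ : h (a ⊕ b) ∈ Tr → h a ∈ Tr ⊎ h b ∈ Tr
  ⊕-Tr⁻ = ⊕₄-Tr⁻ _ _ ∘ subst Tr (oplus-homo _ _)

  ⊕-Tr⁺ : h a ∈ Tr ⊎ h b ∈ Tr → h (a ⊕ b) ∈ Tr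
  ⊕-Tr⁺ = subst Tr (sym (oplus-homo _ _)) ∘ ⊕₄-Tr⁺ _ _

eval : (ℕ → Four) → Fm → Four
eval v (var x) = v x
eval v (a ∧ b) = eval v a ∧₄ eval v b
eval v (a ∨ b) = eval v a ∨₄ eval v b
eval v (a ⊗ b) = eval v a ⊗₄ eval v b
eval v (a ⊕ b) = eval v a ⊕₄ eval v b
eval v (¬ a)   = ¬₄ eval v a

eval-hom : ∀ v → IsHomomorphism 𝐅𝐦 𝓕𝓞𝓤𝓡 (eval v)
eval-hom v = record
  { and-homo = λ _ _ → refl ; or-homo = λ _ _ → refl ; otimes-homo = λ _ _ → refl
  ; oplus-homo = λ _ _ → refl ; neg-homo = λ _ → refl }

-- The logic LB

-- Consequence quantifies over models, so an inclusion of closures reduces to the reverse inclusion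
-- of classes of models.
C-LB-anti : (∀ {h} → IsHomomorphism 𝐅𝐦 𝓕𝓞𝓤𝓡 h →
             (∀ {γ} → γ ∈ Γ → h γ ∈ Tr) → (∀ {δ} → δ ∈ Δ → h δ ∈ Tr)) →
            C-LB Δ ⊆ C-LB Γ
C-LB-anti Γ⊨Δ φ∈ h hom hΓ = φ∈ h hom (Γ⊨Δ hom hΓ)

C-LB-singleton : (∀ {h} → IsHomomorphism 𝐅𝐦 𝓕𝓞𝓤𝓡 h → h a ≡ h b) →
                 C-LB ｛ a ｝ ≐ C-LB ｛ b ｝
C-LB-singleton a≈b =
    C-LB-anti (λ { hom hb refl → subst Tr (sym (a≈b hom)) (hb refl) })
  , C-LB-anti (λ { hom ha refl → subst Tr (a≈b hom) (ha refl) })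

C-LB-PC : PC C-LB
C-LB-PC φ ψ =
    ( C-LB-anti (λ { hom h⊗ refl → ∧-Tr⁺ hom (⊗-Tr⁻ hom (h⊗ refl)) })
    , C-LB-anti (λ { hom h∧ refl → ⊗-Tr⁺ hom (∧-Tr⁻ hom (h∧ refl)) }))
  , ( C-LB-anti (λ { hom hφψ refl → ⊗-Tr⁺ hom (hφψ (inj₁ refl) , hφψ (inj₂ refl)) })
    , C-LB-anti (λ { hom h⊗ (inj₁ refl) → proj₁ (⊗-Tr⁻ hom (h⊗ refl))
                   ; hom h⊗ (inj₂ refl) → proj₂ (⊗-Tr⁻ hom (h⊗ refl)) }))

C-LB-PDI : PDI C-LB
C-LB-PDI Γ φ ψ =
    ( C-LB-anti (λ { hom hΓ (inj₁ γ∈) → hΓ (inj₁ γ∈)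
                   ; hom hΓ (inj₂ refl) → ∨-Tr⁺ hom (⊕-Tr⁻ hom (hΓ (inj₂ refl))) })
    , C-LB-anti (λ { hom hΓ (inj₁ γ∈) → hΓ (inj₁ γ∈)
                   ; hom hΓ (inj₂ refl) → ⊕-Tr⁺ hom (∨-Tr⁻ hom (hΓ (inj₂ refl))) }))
  , ( (λ χ∈ →
          C-LB-anti (λ { hom hΓ (inj₁ γ∈) → hΓ (inj₁ γ∈)
                       ; hom hΓ (inj₂ refl) → ⊕-Tr⁺ hom (inj₁ (hΓ (inj₂ refl))) }) χ∈
        , C-LB-anti (λ { hom hΓ (inj₁ γ∈) → hΓ (inj₁ γ∈)
                       ; hom hΓ (inj₂ refl) → ⊕-Tr⁺ hom (inj₂ (hΓ (inj₂ refl))) }) χ∈)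
    , λ {χ} → elim {χ})
  where
  elim : C-LB (Γ ∪ ｛ φ ｝) ∩ C-LB (Γ ∪ ｛ ψ ｝) ⊆ C-LB (Γ ∪ ｛ φ ⊕ ψ ｝)
  -- `Tr` is prime for `⊕₄`, so the valuation itself selects the disjunct.
  elim (χ∈φ , χ∈ψ) h hom hΓ with ⊕-Tr⁻ hom (hΓ (inj₂ refl))
  ... | inj₁ hφ = χ∈φ h hom λ { (inj₁ γ∈) → hΓ (inj₁ γ∈) ; (inj₂ refl) → hφ }
  ... | inj₂ hψ = χ∈ψ h hom λ { (inj₁ γ∈) → hΓ (inj₁ γ∈) ; (inj₂ refl) → hψ }

C-LB-PDN : PDN C-LB
C-LB-PDN φ = C-LB-singleton λ {h} hom → let open IsHomomorphism hom in
  trans (¬₄-involutive (h φ))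
        (sym (trans (neg-homo (¬ φ)) (cong ¬₄_ (neg-homo φ))))

C-LB-PDM : PDM C-LB
C-LB-PDM φ ψ =
    C-LB-singleton (λ hom → let open IsHomomorphism hom in
      deMorgan hom _∧₄_ _∨₄_ (and-homo _ _) (or-homo _ _) ¬₄-∧₄)
  , C-LB-singleton (λ hom → let open IsHomomorphism hom in
      deMorgan hom _∨₄_ _∧₄_ (or-homo _ _) (and-homo _ _) ¬₄-∨₄)
  , C-LB-singleton (λ hom → let open IsHomomorphism hom in
      deMorgan hom _⊗₄_ _⊗₄_ (otimes-homo _ _) (otimes-homo _ _) ¬₄-⊗₄)
  , C-LB-singleton (λ hom → let open IsHomomorphism hom in
      deMorgan hom _⊕₄_ _⊕₄_ (oplus-homo _ _) (oplus-homo _ _) ¬₄-⊕₄)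
  where
  deMorgan : ∀ {h} → IsHomomorphism 𝐅𝐦 𝓕𝓞𝓤𝓡 h → (_∙_ _∙ᵈ_ : Four → Four → Four) →
             h a ≡ (h φ ∙ h ψ) → h b ≡ (h (¬ φ) ∙ᵈ h (¬ ψ)) →
             (∀ u v → ¬₄ (u ∙ v) ≡ (¬₄ u) ∙ᵈ (¬₄ v)) →
             h (¬ a) ≡ h b
  deMorgan {a} {h = h} hom _ _ a≡ b≡ dual
    rewrite IsHomomorphism.neg-homo hom a | a≡ | b≡
          | IsHomomorphism.neg-homo hom φ | IsHomomorphism.neg-homo hom ψ =
    dual (h φ) (h ψ)

C-LB-isLogic : IsLogic C-LB
C-LB-isLogic = record
  { extensive  = λ Γ φ∈ h hom hΓ → hΓ φ∈
  ; monotone   = λ Γ Δ Γ⊆Δ φ∈ h hom hΔ → φ∈ h hom (hΔ ∘ Γ⊆Δ)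
  ; idempotent = λ Γ →
      (λ φ∈ h hom hΓ → φ∈ h hom (λ γ∈ → γ∈ h hom hΓ))
    , (λ φ∈ h hom hCΓ → hCΓ φ∈)
  ; structural = λ σ σ-hom Γ φ φ∈ h hom hσΓ →
      φ∈ (h ∘ σ) (∘-hom hom σ-hom) (λ γ∈ → hσΓ (_ , γ∈ , refl))
  }
  where
  ∘-hom : ∀ {h σ} → IsHomomorphism 𝐅𝐦 𝓕𝓞𝓤𝓡 h → IsHomomorphism 𝐅𝐦 𝐅𝐦 σ →
          IsHomomorphism 𝐅𝐦 𝓕𝓞𝓤𝓡 (h ∘ σ)
  ∘-hom {h} H S = record
    { and-homo    = λ x y → trans (cong h (S.and-homo x y)) (H.and-homo _ _)
    ; or-homo     = λ x y → trans (cong h (S.or-homo x y)) (H.or-homo _ _)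
    ; otimes-homo = λ x y → trans (cong h (S.otimes-homo x y)) (H.otimes-homo _ _)
    ; oplus-homo  = λ x y → trans (cong h (S.oplus-homo x y)) (H.oplus-homo _ _)
    ; neg-homo    = λ x → trans (cong h (S.neg-homo x)) (H.neg-homo _)
    }
    where
    module H = IsHomomorphism H
    module S = IsHomomorphism S

C-LB-consistent : Consistent C-LB
C-LB-consistent = var 0 , var 1 , λ 1∈ →
  f∉Tr (1∈ (eval v) (eval-hom v) λ { refl → t∈Tr })
  where
  v : ℕ → Four
  v zero    = t₄
  v (suc _) = f₄
  f∉Tr : f₄ ∉ Tr
  f∉Tr ()

-- Logics with (PC), (PDI), (PDN) and (PDM)

substitute : (ℕ → Fm) → Fm → Fm
substitute s (var x) = s x
substitute s (a ∧ b) = substitute s a ∧ substitute s b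
substitute s (a ∨ b) = substitute s a ∨ substitute s b
substitute s (a ⊗ b) = substitute s a ⊗ substitute s b
substitute s (a ⊕ b) = substitute s a ⊕ substitute s b
substitute s (¬ a)   = ¬ substitute s a

substitute-hom : ∀ s → IsHomomorphism 𝐅𝐦 𝐅𝐦 (substitute s)
substitute-hom s = record
  { and-homo = λ _ _ → refl ; or-homo = λ _ _ → refl ; otimes-homo = λ _ _ → refl
  ; oplus-homo = λ _ _ → refl ; neg-homo = λ _ → refl }

module _ {C : Operator} (logic : IsLogic C) where
  open IsLogic logic

  C-least : Γ ⊆ C Δ → C Γ ⊆ C Δ
  C-least {Γ} {Δ} Γ⊆ = proj₁ (idempotent Δ) ∘ monotone Γ (C Δ) Γ⊆

  -- This is (PDI) at the empty context. It is stated for any logic because `⊕-settled` uses it for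
  -- `C` and for `C-LB`.
  PDI⇒∨≐⊕ : PDI C → ∀ a b → C ｛ a ∨ b ｝ ≐ C ｛ a ⊕ b ｝
  PDI⇒∨≐⊕ pdi a b =
      add⊥ ∘ proj₁ (proj₁ (pdi ∅ a b)) ∘ drop⊥
    , add⊥ ∘ proj₂ (proj₁ (pdi ∅ a b)) ∘ drop⊥
    where
    drop⊥ : C ｛ c ｝ ⊆ C (∅ ∪ ｛ c ｝)
    drop⊥ = monotone _ _ inj₂
    add⊥ : C (∅ ∪ ｛ c ｝) ⊆ C ｛ c ｝
    add⊥ = monotone _ _ λ { (inj₂ c≡) → c≡ }

-- Finite meets and joins, and unions of chains

data Meets (A : Pred Fm 0ℓ) : Pred Fm 0ℓ where
  base : a ∈ A → a ∈ Meets A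
  _∧_  : a ∈ Meets A → b ∈ Meets A → a ∧ b ∈ Meets A

data Joins (R : Pred Fm 0ℓ) : Pred Fm 0ℓ where
  base : a ∈ R → a ∈ Joins R
  _∨_  : a ∈ Joins R → b ∈ Joins R → a ∨ b ∈ Joins R

Meets-mono : P ⊆ Q → Meets P ⊆ Meets Q
Meets-mono P⊆Q (base a) = base (P⊆Q a)
Meets-mono P⊆Q (a ∧ b)  = Meets-mono P⊆Q a ∧ Meets-mono P⊆Q b

Joins-mono : P ⊆ Q → Joins P ⊆ Joins Q
Joins-mono P⊆Q (base a) = base (P⊆Q a)
Joins-mono P⊆Q (a ∨ b)  = Joins-mono P⊆Q a ∨ Joins-mono P⊆Q b

⋃ : (ℕ → Pred Fm 0ℓ) → Pred Fm 0ℓ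
⋃ A a = ∃[ n ] a ∈ A n

chain-mono : {A : ℕ → Pred Fm 0ℓ} → (∀ n → A n ⊆ A (suc n)) →
             ∀ {m n} → m ≤′ n → A m ⊆ A n
chain-mono step ≤′-refl       = id
chain-mono step (≤′-step m≤n) = step _ ∘ chain-mono step m≤n

module _ {A : ℕ → Pred Fm 0ℓ} (step : ∀ n → A n ⊆ A (suc n)) where

  left : ∀ m n → A m ⊆ A (m ⊔ℕ n)
  left m n = chain-mono step (≤⇒≤′ (m≤m⊔n m n))

  right : ∀ m n → A n ⊆ A (m ⊔ℕ n)
  right m n = chain-mono step (≤⇒≤′ (m≤n⊔m m n))

  -- Only finitely many members of the union occur, so the largest of their indices serves for all.
  -- Membership in `C` would not do instead of `Meets`: `C` is not assumed finitary.
  Meets-⋃ : a ∈ Meets (⋃ A) → ∃[ n ] a ∈ Meets (A n)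
  Meets-⋃ (base (n , a)) = n , base a
  Meets-⋃ (a ∧ b) with Meets-⋃ a | Meets-⋃ b
  ... | m , a′ | n , b′ = m ⊔ℕ n , Meets-mono (left m n) a′ ∧ Meets-mono (right m n) b′

  Joins-⋃ : a ∈ Joins (⋃ A) → ∃[ n ] a ∈ Joins (A n)
  Joins-⋃ (base (n , a)) = n , base a
  Joins-⋃ (a ∨ b) with Joins-⋃ a | Joins-⋃ b
  ... | m , a′ | n , b′ = m ⊔ℕ n , Joins-mono (left m n) a′ ∨ Joins-mono (right m n) b′

-- Rules of entailment between single formulas

module Uniqueness {C : Operator} (logic : IsLogic C)
                  (pc : PC C) (pdi : PDI C) (pdn : PDN C) (pdm : PDM C) where
  open IsLogic logic

  infix 4 _⊢_
  _⊢_ : Fm → Fm → Set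
  a ⊢ b = b ∈ C ｛ a ｝

  ⊢-refl : a ⊢ a
  ⊢-refl = extensive _ refl

  ⊢-C : a ∈ C Γ → a ⊢ b → b ∈ C Γ
  ⊢-C a∈ = C-least logic λ { refl → a∈ }

  ⊢-trans : a ⊢ b → b ⊢ c → a ⊢ c
  ⊢-trans = ⊢-C

  ≐⇒⊢ : C ｛ a ｝ ≐ C ｛ b ｝ → b ⊢ a
  ≐⇒⊢ (a⊆b , _) = a⊆b ⊢-refl

  ≐⇒⊣ : C ｛ a ｝ ≐ C ｛ b ｝ → a ⊢ b
  ≐⇒⊣ (_ , b⊆a) = b⊆a ⊢-refl

  ⊗⊢₁ : a ⊗ b ⊢ a
  ⊗⊢₁ = proj₂ (proj₂ (pc _ _)) (extensive _ (inj₁ refl))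

  ⊗⊢₂ : a ⊗ b ⊢ b
  ⊗⊢₂ = proj₂ (proj₂ (pc _ _)) (extensive _ (inj₂ refl))

  ∧⊢⊗ : a ∧ b ⊢ a ⊗ b
  ∧⊢⊗ = ≐⇒⊣ (proj₁ (pc _ _))

  ∧⊢₁ : a ∧ b ⊢ a
  ∧⊢₁ = ⊢-trans ∧⊢⊗ ⊗⊢₁

  ∧⊢₂ : a ∧ b ⊢ b
  ∧⊢₂ = ⊢-trans ∧⊢⊗ ⊗⊢₂

  ∧-closed : a ∈ C Γ → b ∈ C Γ → a ∧ b ∈ C Γ
  ∧-closed a∈ b∈ =
    C-least logic (λ { (inj₁ refl) → a∈ ; (inj₂ refl) → b∈ })
      (proj₁ (proj₂ (pc _ _)) (proj₁ (proj₁ (pc _ _)) ⊢-refl))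

  ∨⊢⊕ : a ∨ b ⊢ a ⊕ b
  ∨⊢⊕ = ≐⇒⊣ (PDI⇒∨≐⊕ logic pdi _ _)

  ⊕⊢∨ : a ⊕ b ⊢ a ∨ b
  ⊕⊢∨ = ≐⇒⊢ (PDI⇒∨≐⊕ logic pdi _ _)

  ⊢⊕₁ : a ⊢ a ⊕ b
  ⊢⊕₁ = monotone _ _ (λ { (inj₂ a≡) → a≡ })
          (proj₁ (proj₁ (proj₂ (pdi ∅ _ _)) (extensive _ (inj₂ refl))))

  ⊢⊕₂ : b ⊢ a ⊕ b
  ⊢⊕₂ = monotone _ _ (λ { (inj₂ b≡) → b≡ })
          (proj₂ (proj₁ (proj₂ (pdi ∅ _ _)) (extensive _ (inj₂ refl))))

  ⊢∨₁ : a ⊢ a ∨ b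
  ⊢∨₁ = ⊢-trans ⊢⊕₁ ⊕⊢∨

  ⊢∨₂ : b ⊢ a ∨ b
  ⊢∨₂ = ⊢-trans ⊢⊕₂ ⊕⊢∨

  -- (PDI) with context `｛ d ｝`. The side formula `d` is available in both cases, which amounts to
  -- distributivity; `cut` depends on it.
  ∨-elim : d ⊢ a ∨ b → d ∧ a ⊢ c → d ∧ b ⊢ c → d ⊢ c
  ∨-elim {d} {a} {b} d⊢ a⊢c b⊢c =
    C-least logic (λ { (inj₁ refl) → ⊢-refl ; (inj₂ refl) → ⊢-trans d⊢ ∨⊢⊕ })
      (proj₂ (proj₂ (pdi ｛ d ｝ a b)) (from-∧ a⊢c , from-∧ b⊢c))
    where
    from-∧ : ∀ {x} → d ∧ x ⊢ c → c ∈ C (｛ d ｝ ∪ ｛ x ｝)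
    from-∧ = ⊢-C (∧-closed (extensive _ (inj₁ refl)) (extensive _ (inj₂ refl)))

  ∨-least : a ⊢ c → b ⊢ c → a ∨ b ⊢ c
  ∨-least a⊢c b⊢c = ∨-elim ⊢-refl (⊢-trans ∧⊢₂ a⊢c) (⊢-trans ∧⊢₂ b⊢c)

  -- Filters, ideals and the truth lemma

  record IsFilter (F : Pred Fm 0ℓ) : Set where
    field
      upward : a ⊢ b → a ∈ F → b ∈ F
      meet   : a ∈ F → b ∈ F → a ∧ b ∈ F

  record IsIdeal (I : Pred Fm 0ℓ) : Set where
    field
      downward : a ⊢ b → b ∈ I → a ∈ I
      join     : a ∈ I → b ∈ I → a ∨ b ∈ I

  module _ (F I : Pred Fm 0ℓ) where

    -- The implication runs only from truth values to membership: `F` and `I` may overlap and need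
    -- not exhaust the formulas.
    Settles : Four → Fm → Set
    Settles v a = (v ∈ Tr × a ∈ F) ⊎ (v ∉ Tr × a ∈ I)

    -- The truth of `¬ a` is independent of that of `a`; the two together determine an element of
    -- `Four`.
    SettlesLiterals : Four → Fm → Set
    SettlesLiterals v a = Settles v a × Settles (¬₄ v) (¬ a)

  module Truth {F I : Pred Fm 0ℓ} (filter : IsFilter F) (ideal : IsIdeal I)
               {h : Fm → Four} (hom : IsHomomorphism 𝐅𝐦 𝓕𝓞𝓤𝓡 h)
               (literals : ∀ x → SettlesLiterals F I (h (var x)) (var x)) where
    open IsFilter filter
    open IsIdeal ideal

    Settled : Fm → Set
    Settled a = Settles F I (h a) a

    ∧-settled : Settled a → Settled b → Settled (a ∧ b)
    ∧-settled (inj₁ (ta , a∈)) (inj₁ (tb , b∈)) = inj₁ (∧-Tr⁺ hom (ta , tb) , meet a∈ b∈)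
    ∧-settled (inj₁ _) (inj₂ (¬tb , b∈)) = inj₂ (¬tb ∘ proj₂ ∘ ∧-Tr⁻ hom , downward ∧⊢₂ b∈)
    ∧-settled (inj₂ (¬ta , a∈)) _        = inj₂ (¬ta ∘ proj₁ ∘ ∧-Tr⁻ hom , downward ∧⊢₁ a∈)

    ∨-settled : Settled a → Settled b → Settled (a ∨ b)
    ∨-settled (inj₁ (ta , a∈)) _          = inj₁ (∨-Tr⁺ hom (inj₁ ta) , upward ⊢∨₁ a∈)
    ∨-settled (inj₂ _) (inj₁ (tb , b∈))   = inj₁ (∨-Tr⁺ hom (inj₂ tb) , upward ⊢∨₂ b∈)
    ∨-settled (inj₂ (¬ta , a∈)) (inj₂ (¬tb , b∈)) =
      inj₂ ((λ { (inj₁ ta) → ¬ta ta ; (inj₂ tb) → ¬tb tb }) ∘ ∨-Tr⁻ hom , join a∈ b∈)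

    -- Equivalence in `C` preserves membership in filters and ideals, equivalence in `C-LB`
    -- preserves truth under `h`. Both logics obey the same laws, so each law is invoked once for
    -- either side.
    transfer : C ｛ a ｝ ≐ C ｛ b ｝ → C-LB ｛ a ｝ ≐ C-LB ｛ b ｝ → Settled a → Settled b
    transfer C≐ LB≐ (inj₁ (ta , a∈)) =
      inj₁ (proj₂ LB≐ (λ _ _ hb → hb refl) h hom (λ { refl → ta }) , upward (≐⇒⊣ C≐) a∈)
    transfer C≐ LB≐ (inj₂ (¬ta , a∈)) =
      inj₂ ( (λ tb → ¬ta (proj₁ LB≐ (λ _ _ ha → ha refl) h hom (λ { refl → tb })))
           , downward (≐⇒⊢ C≐) a∈)

    ⊗-settled : Settled a → Settled b → Settled (a ⊗ b)
    ⊗-settled a b = transfer (proj₁ (pc _ _)) (proj₁ (C-LB-PC _ _)) (∧-settled a b)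

    ⊕-settled : Settled a → Settled b → Settled (a ⊕ b)
    ⊕-settled a b =
      transfer (PDI⇒∨≐⊕ logic pdi _ _) (PDI⇒∨≐⊕ C-LB-isLogic C-LB-PDI _ _) (∨-settled a b)

    ≐-sym : P ≐ Q → Q ≐ P
    ≐-sym (P⊆Q , Q⊆P) = Q⊆P , P⊆Q

    -- Induction must carry the negation along: (PDM) reduces a negated compound to the negations of
    -- its components, and (PDN) handles a double negation.
    settled± : ∀ a → Settled a × Settled (¬ a)
    settled± (var x) = proj₁ (literals x)
      , subst (λ v → Settles F I v (¬ var x))
          (sym (IsHomomorphism.neg-homo hom (var x))) (proj₂ (literals x))
    settled± (a ∧ b) with settled± a | settled± b | pdm a b | C-LB-PDM a b
    ... | a⁺ , a⁻ | b⁺ , b⁻ | C≐ , _ | LB≐ , _ =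
      ∧-settled a⁺ b⁺ , transfer (≐-sym C≐) (≐-sym LB≐) (∨-settled a⁻ b⁻)
    settled± (a ∨ b) with settled± a | settled± b | pdm a b | C-LB-PDM a b
    ... | a⁺ , a⁻ | b⁺ , b⁻ | _ , C≐ , _ | _ , LB≐ , _ =
      ∨-settled a⁺ b⁺ , transfer (≐-sym C≐) (≐-sym LB≐) (∧-settled a⁻ b⁻)
    settled± (a ⊗ b) with settled± a | settled± b | pdm a b | C-LB-PDM a b
    ... | a⁺ , a⁻ | b⁺ , b⁻ | _ , _ , C≐ , _ | _ , _ , LB≐ , _ =
      ⊗-settled a⁺ b⁺ , transfer (≐-sym C≐) (≐-sym LB≐) (⊗-settled a⁻ b⁻)
    settled± (a ⊕ b) with settled± a | settled± b | pdm a b | C-LB-PDM a b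
    ... | a⁺ , a⁻ | b⁺ , b⁻ | _ , _ , _ , C≐ | _ , _ , _ , LB≐ =
      ⊕-settled a⁺ b⁺ , transfer (≐-sym C≐) (≐-sym LB≐) (⊕-settled a⁻ b⁻)
    settled± (¬ a) with settled± a
    ... | a⁺ , a⁻ = a⁻ , transfer (pdn a) (C-LB-PDN a) a⁺

    truth : h a ∈ Tr → a ∈ F
    truth {a} ta with proj₁ (settled± a)
    ... | inj₁ (_ , a∈)  = a∈
    ... | inj₂ (¬ta , _) = ⊥-elim (¬ta ta)

    falsity : h a ∉ Tr → a ∈ I
    falsity {a} ¬ta with proj₁ (settled± a)
    ... | inj₁ (ta , _) = ⊥-elim (¬ta ta)
    ... | inj₂ (_ , a∈) = a∈

  -- Formulas simulating the truth values

  module _ (α β : Fm) where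

    -- Substitutes for the missing constants ⊤ and ⊥, relative to the pair `α`, `β`.
    both neither : Fm
    both    = α ⊕ ¬ α
    neither = β ⊗ ¬ β

    ⊢both : α ⊢ both
    ⊢both = ⊢⊕₁

    -- By (PDM) `¬ both` amounts to `¬ α ⊕ ¬ ¬ α`, and by (PDN) `α` entails the second disjunct.
    ⊢¬both : α ⊢ ¬ both
    ⊢¬both = ⊢-trans (≐⇒⊣ (pdn α))
      (⊢-trans ⊢⊕₂ (≐⇒⊢ (proj₂ (proj₂ (proj₂ (pdm α (¬ α)))))))

    neither⊢ : neither ⊢ β
    neither⊢ = ⊗⊢₁

    ¬neither⊢ : ¬ neither ⊢ β
    ¬neither⊢ = ⊢-trans (≐⇒⊣ (proj₁ (proj₂ (proj₂ (pdm β (¬ β))))))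
      (⊢-trans ⊗⊢₂ (≐⇒⊢ (pdn β)))

    value : Four → Fm
    value f₄ = both ∧ neither
    value ⊥₄ = neither
    value ⊤₄ = both
    value t₄ = both ∨ neither

    value-settles : ∀ v → SettlesLiterals (α ⊢_) (_⊢ β) v (value v)
    value-settles f₄ =
        inj₂ ((λ ()) , ⊢-trans ∧⊢₂ neither⊢)
      , inj₁ (t∈Tr , ⊢-trans ⊢¬both (⊢-trans ⊢∨₁ (≐⇒⊢ (proj₁ (pdm _ _)))))
    value-settles ⊥₄ = inj₂ ((λ ()) , neither⊢) , inj₂ ((λ ()) , ¬neither⊢)
    value-settles ⊤₄ = inj₁ (⊤∈Tr , ⊢both) , inj₁ (⊤∈Tr , ⊢¬both)
    value-settles t₄ =
        inj₁ (t∈Tr , ⊢-trans ⊢both ⊢∨₁)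
      , inj₂ ((λ ()) , ⊢-trans (≐⇒⊣ (proj₁ (proj₂ (pdm _ _)))) (⊢-trans ∧⊢₂ ¬neither⊢))

  refutable⇒trivial : ∀ {h φ} → IsHomomorphism 𝐅𝐦 𝓕𝓞𝓤𝓡 h →
                      (∀ {γ} → γ ∈ Γ → h γ ∈ Tr) → h φ ∉ Tr →
                      φ ∈ C Γ → ∀ α β → α ⊢ β
  refutable⇒trivial {Γ} {h} {φ} hom hΓ ¬hφ φ∈ α β =
    ⊢-C (C-least logic (λ { (_ , γ∈ , refl) → T.truth (hΓ γ∈) })
          (structural σ (substitute-hom _) Γ φ φ∈))
        (T.falsity ¬hφ)
    where
    σ : Fm → Fm
    σ = substitute (value α β ∘ h ∘ var)

    σ-mono : a ⊢ b → σ a ⊢ σ b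
    σ-mono a⊢b = monotone _ _ (λ { (_ , refl , refl) → refl })
                   (structural σ (substitute-hom _) _ _ a⊢b)

    -- Taking preimages along `σ` lets `Truth` speak of the formulas of `Γ` and of `φ` themselves;
    -- structurality makes the preimages a filter and an ideal.
    filter : IsFilter (λ a → α ⊢ σ a)
    filter = record { upward = λ a⊢b a∈ → ⊢-trans a∈ (σ-mono a⊢b) ; meet = ∧-closed }

    ideal : IsIdeal (λ a → σ a ⊢ β)
    ideal = record { downward = λ a⊢b → ⊢-trans (σ-mono a⊢b) ; join = ∨-least }

    module T = Truth filter ideal hom (λ x → value-settles α β (h (var x)))

  C⊆C-LB : Consistent C → C Γ ⊆ C-LB Γ
  -- `Tr` is decidable, so this case distinction is constructive.
  C⊆C-LB (α , β , α⊬β) {φ} φ∈ h hom hΓ with Tr? (h φ)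
  ... | yes hφ = hφ
  ... | no ¬hφ = ⊥-elim (α⊬β (refutable⇒trivial hom hΓ ¬hφ φ∈ α β))

  -- Generated filters and ideals, and their separation

  ↑ : Pred Fm 0ℓ → Pred Fm 0ℓ
  ↑ A b = ∃[ a ] a ∈ Meets A × a ⊢ b

  ↓ : Pred Fm 0ℓ → Pred Fm 0ℓ
  ↓ R b = ∃[ r ] r ∈ Joins R × b ⊢ r

  ↑-filter : IsFilter (↑ P)
  ↑-filter = record
    { upward = λ b⊢c (a , a∈ , a⊢b) → a , a∈ , ⊢-trans a⊢b b⊢c
    ; meet   = λ (_ , a∈ , a⊢) (_ , b∈ , b⊢) →
        _ , a∈ ∧ b∈ , ∧-closed (⊢-trans ∧⊢₁ a⊢) (⊢-trans ∧⊢₂ b⊢)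
    }

  ↓-ideal : IsIdeal (↓ P)
  ↓-ideal = record
    { downward = λ a⊢b (r , r∈ , b⊢r) → r , r∈ , ⊢-trans a⊢b b⊢r
    ; join     = λ (_ , a∈ , ⊢a) (_ , b∈ , ⊢b) →
        _ , a∈ ∨ b∈ , ∨-least (⊢-trans ⊢a ⊢∨₁) (⊢-trans ⊢b ⊢∨₂)
    }

  ∈↑ : a ∈ P → a ∈ ↑ P
  ∈↑ a∈ = _ , base a∈ , ⊢-refl

  ∈↓ : a ∈ P → a ∈ ↓ P
  ∈↓ a∈ = _ , base a∈ , ⊢-refl

  -- This says that `↑ A` meets `↓ R`. The evidence is finite, so an overlap of unions of chains
  -- already occurs at some stage.
  Overlap : (A R : Pred Fm 0ℓ) → Set
  Overlap A R = ∃[ a ] ∃[ r ] a ∈ Meets A × r ∈ Joins R × a ⊢ r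

  Overlap⁺ : a ∈ ↑ P → a ∈ ↓ Q → Overlap P Q
  Overlap⁺ (_ , b∈ , b⊢a) (_ , r∈ , a⊢r) = _ , _ , b∈ , r∈ , ⊢-trans b⊢a a⊢r

  -- Meets P may be empty, since there is no constant for its top element; hence
  -- the extra element c (and dually below).
  Meets-∪ : c ∈ Meets P → b ∈ Meets (P ∪ ｛ a ｝) → ∃[ d ] d ∈ Meets P × d ∧ a ⊢ b
  Meets-∪ c∈ (base (inj₁ b∈))   = _ , base b∈ , ∧⊢₁
  Meets-∪ c∈ (base (inj₂ refl)) = _ , c∈ , ∧⊢₂
  Meets-∪ c∈ (b₁ ∧ b₂) with Meets-∪ c∈ b₁ | Meets-∪ c∈ b₂
  ... | _ , d₁ , ⊢b₁ | _ , d₂ , ⊢b₂ = _ , d₁ ∧ d₂ ,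
    ∧-closed (⊢-trans (∧-closed (⊢-trans ∧⊢₁ ∧⊢₁) ∧⊢₂) ⊢b₁)
             (⊢-trans (∧-closed (⊢-trans ∧⊢₁ ∧⊢₂) ∧⊢₂) ⊢b₂)

  Joins-∪ : c ∈ Joins P → b ∈ Joins (P ∪ ｛ a ｝) → ∃[ d ] d ∈ Joins P × b ⊢ d ∨ a
  Joins-∪ c∈ (base (inj₁ b∈))   = _ , base b∈ , ⊢∨₁
  Joins-∪ c∈ (base (inj₂ refl)) = _ , c∈ , ⊢∨₂
  Joins-∪ c∈ (b₁ ∨ b₂) with Joins-∪ c∈ b₁ | Joins-∪ c∈ b₂
  ... | _ , d₁ , b₁⊢ | _ , d₂ , b₂⊢ = _ , d₁ ∨ d₂ ,
    ∨-least (⊢-trans b₁⊢ (∨-least (⊢-trans ⊢∨₁ ⊢∨₁) ⊢∨₂))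
            (⊢-trans b₂⊢ (∨-least (⊢-trans ⊢∨₂ ⊢∨₁) ⊢∨₂))

  -- Contrapositively, a separated pair stays separated when `a` joins one of its sides. In the
  -- notation of the proof, `c ∧ d` entails `e ∨ a`; in the case `a`, `d ∧ a` entails `b` and so
  -- `s`. Hence `c ∧ d` entails `s ∨ e`.
  cut : Overlap (P ∪ ｛ a ｝) Q → Overlap P (Q ∪ ｛ a ｝) → Overlap P Q
  cut (_ , _ , b∈ , s∈ , b⊢s) (_ , _ , c∈ , r∈ , c⊢r)
    -- Each overlap supplies the spare element needed to take `a` out of the other.
    with Meets-∪ c∈ b∈ | Joins-∪ s∈ r∈
  ... | _ , d∈ , d∧a⊢b | _ , e∈ , r⊢e∨a = _ , _ , c∈ ∧ d∈ , s∈ ∨ e∈ ,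
    ∨-elim (⊢-trans ∧⊢₁ (⊢-trans c⊢r r⊢e∨a))
      (⊢-trans ∧⊢₂ ⊢∨₂)
      (⊢-trans (∧-closed (⊢-trans ∧⊢₁ ∧⊢₂) ∧⊢₂) (⊢-trans d∧a⊢b (⊢-trans b⊢s ⊢∨₁)))

  record Separation : Set₁ where
    constructor separation
    field
      accepted rejected : Pred Fm 0ℓ
      separated         : Overlap accepted rejected → ⊥

  open Separation

  -- The Lindenbaum construction and completeness

  module Lindenbaum (em : ExcludedMiddle 0ℓ) where

    -- The formula is accepted if that keeps the sides apart; otherwise `cut` shows that rejecting
    -- it does.
    decide : Fm → Separation → Separation
    decide a (separation A R sep) with em {Overlap (A ∪ ｛ a ｝) R}
    ... | yes o = separation A (R ∪ ｛ a ｝) (sep ∘ cut o)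
    ... | no ¬o = separation (A ∪ ｛ a ｝) R ¬o

    decide-accepted : ∀ a S → accepted S ⊆ accepted (decide a S)
    decide-accepted a (separation A R sep) x∈ with em {Overlap (A ∪ ｛ a ｝) R}
    ... | yes _ = x∈
    ... | no _  = inj₁ x∈

    decide-rejected : ∀ a S → rejected S ⊆ rejected (decide a S)
    decide-rejected a (separation A R sep) x∈ with em {Overlap (A ∪ ｛ a ｝) R}
    ... | yes _ = inj₁ x∈
    ... | no _  = x∈

    decided : ∀ a S → a ∈ accepted (decide a S) ⊎ a ∈ rejected (decide a S)
    decided a (separation A R sep) with em {Overlap (A ∪ ｛ a ｝) R}
    ... | yes _ = inj₂ (inj₂ refl)
    ... | no _  = inj₁ (inj₂ refl)

    module Limit (S : Separation) where

      -- Only literals are decided, a variable and then its negation; `Truth` extends the outcome to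
      -- all formulas.
      half stage : ℕ → Separation
      half n        = decide (var n) (stage n)
      stage zero    = S
      stage (suc n) = decide (¬ var n) (half n)

      accepted-step : ∀ n → accepted (stage n) ⊆ accepted (stage (suc n))
      accepted-step n = decide-accepted (¬ var n) (half n) ∘ decide-accepted (var n) (stage n)

      rejected-step : ∀ n → rejected (stage n) ⊆ rejected (stage (suc n))
      rejected-step n = decide-rejected (¬ var n) (half n) ∘ decide-rejected (var n) (stage n)

      A R : Pred Fm 0ℓ
      A = ⋃ (accepted ∘ stage)
      R = ⋃ (rejected ∘ stage)

      limit-separated : Overlap A R → ⊥
      limit-separated (_ , _ , a∈ , r∈ , a⊢r)
        with Meets-⋃ accepted-step a∈ | Joins-⋃ rejected-step r∈
      ... | m , a∈m | n , r∈n = separated (stage (m ⊔ℕ n))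
        (_ , _ , Meets-mono (left accepted-step m n) a∈m
               , Joins-mono (right rejected-step m n) r∈n , a⊢r)

      var-decided : ∀ n → var n ∈ A ⊎ var n ∈ R
      var-decided n with decided (var n) (stage n)
      -- The variable enters at `half n`, which is not a stage; the next stage is `suc n`.
      ... | inj₁ ∈A = inj₁ (suc n , decide-accepted (¬ var n) (half n) ∈A)
      ... | inj₂ ∈R = inj₂ (suc n , decide-rejected (¬ var n) (half n) ∈R)

      ¬var-decided : ∀ n → ¬ var n ∈ A ⊎ ¬ var n ∈ R
      ¬var-decided n with decided (¬ var n) (half n)
      ... | inj₁ ∈A = inj₁ (suc n , ∈A)
      ... | inj₂ ∈R = inj₂ (suc n , ∈R)

      literal-value : ∀ n → Σ Four λ v → SettlesLiterals (↑ A) (↓ R) v (var n)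
      literal-value n with var-decided n | ¬var-decided n
      ... | inj₁ p | inj₁ q = ⊤₄ , inj₁ (⊤∈Tr , ∈↑ p) , inj₁ (⊤∈Tr , ∈↑ q)
      ... | inj₁ p | inj₂ q = t₄ , inj₁ (t∈Tr , ∈↑ p) , inj₂ ((λ ()) , ∈↓ q)
      ... | inj₂ p | inj₁ q = f₄ , inj₂ ((λ ()) , ∈↓ p) , inj₁ (t∈Tr , ∈↑ q)
      ... | inj₂ p | inj₂ q = ⊥₄ , inj₂ ((λ ()) , ∈↓ p) , inj₂ ((λ ()) , ∈↓ q)

      model : Fm → Four
      model = eval (proj₁ ∘ literal-value)

      model-hom : IsHomomorphism 𝐅𝐦 𝓕𝓞𝓤𝓡 model
      model-hom = eval-hom _

      open Truth ↑-filter ↓-ideal model-hom (proj₂ ∘ literal-value)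

      -- Were `a` not true, `falsity` would put it into `↓ R`, while acceptance at stage 0 puts it
      -- into `↑ A`.
      model-accepted : a ∈ accepted S → model a ∈ Tr
      model-accepted {a} a∈ with Tr? (model a)
      ... | yes ta = ta
      ... | no ¬ta = ⊥-elim (limit-separated (Overlap⁺ (∈↑ (0 , a∈)) (falsity ¬ta)))

      model-rejected : a ∈ rejected S → model a ∉ Tr
      model-rejected a∈ ta = limit-separated (Overlap⁺ (truth ta) (∈↓ (0 , a∈)))

    Meets⊆C : Meets Γ ⊆ C Γ
    Meets⊆C (base a∈) = extensive _ a∈
    Meets⊆C (a ∧ b)   = ∧-closed (Meets⊆C a) (Meets⊆C b)

    Joins-singleton : b ∈ Joins ｛ a ｝ → b ⊢ a
    Joins-singleton (base refl) = ⊢-refl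
    Joins-singleton (b ∨ c)     = ∨-least (Joins-singleton b) (Joins-singleton c)

    C-LB⊆C : C-LB Γ ⊆ C Γ
    C-LB⊆C {Γ} {φ} φ∈ with em {φ ∈ C Γ}
    ... | yes φ∈C = φ∈C
    ... | no φ∉C  = ⊥-elim (model-rejected refl (φ∈ model model-hom model-accepted))
      where
      -- The initial pair is separated: a join of copies of `φ` entails `φ`, so an overlap would put
      -- `φ` into `C Γ`.
      open Limit (separation Γ ｛ φ ｝ λ (_ , _ , a∈ , r∈ , a⊢r) →
        φ∉C (⊢-C (Meets⊆C a∈) (⊢-trans a⊢r (Joins-singleton r∈))))

proposition3p3p3 : (PC C-LB × PDI C-LB × PDN C-LB × PDM C-LB) ×
    (IsLogic C-LB × Consistent C-LB) ×
    (ExcludedMiddle 0ℓ →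
    ∀ (C : Operator) → IsLogic C → Consistent C →
    PC C → PDI C → PDN C → PDM C →
    ∀ Γ → C Γ ≐ C-LB Γ)
proposition3p3p3 =
    (C-LB-PC , C-LB-PDI , C-LB-PDN , C-LB-PDM)
  , (C-LB-isLogic , C-LB-consistent)
  , λ em C logic consistent pc pdi pdn pdm Γ →
      let open Uniqueness logic pc pdi pdn pdm in
      C⊆C-LB consistent , Lindenbaum.C-LB⊆C em
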